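{- If $n$ is odd, then whether a one-column two-color Clickomania puzzle with $n$ groups is solvable can be decided in time $O(n)$. If the puzzle is solvable, a solution can also be found in time $O(n)$.
   Context: A one-column two-color Clickomania puzzle is a finite word over a two-letter alphabet; its letters are called blocks. A group is a maximal run of consecutive equal letters; the puzzle is given by its groups $g_1,\dots,g_n$ in order (with their sizes). A move (click) deletes a group of size at least two from the current word; the remaining parts are then concatenated (so that the two neighbors of the deleted group, if there are two, merge into one group). A puzzle is solvable if some sequence of moves deletes all blocks; such a sequence is called a solution. In this setting a group with more than two blocks is equivalent to a group with just two blocks, so the problem can be reduced, in time linear in the number of blocks, to one of size linear in $n$; the time bounds refer to the reduced problem, in the usual unit-cost RAM model. -}

module Defs where

open import Data.Bool using (if_then_else_)
open import Data.Fin using (Fin; toℕ; _≟_)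
open import Data.List using (List; []; _∷_; _++_; _∷ʳ_; length; map; concatMap; replicate; foldr; head; drop)
open import Data.Maybe using (Maybe; just; nothing)
open import Data.Nat using (ℕ; suc; _+_; _∸_; _⊓_; _≤_; _≡ᵇ_; _%_)
open import Data.Product using (_×_; _,_; ∃-syntax; map₂)
open import Relation.Nullary using (does)
open import Relation.Binary.PropositionalEquality using (_≡_)

Odd : ℕ → Set
Odd n = n % 2 ≡ 1

Letter : Set
Letter = Fin 2

Word : Set
Word = List Letter

Group : Set
Group = Letter × ℕ

addBlock : Letter → List Group → List Group
addBlock c []             = (c , 1) ∷ []
addBlock c ((d , k) ∷ gs) =
  if does (c ≟ d) then (d , suc k) ∷ gs else (c , 1) ∷ (d , k) ∷ gs

groups : Word → List Group
groups = foldr addBlock []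

blocks : List Group → Word
blocks = concatMap (λ (c , k) → replicate k c)

-- Moves are numbered by the position, counted from 0, of the clicked
-- group among the groups of the current word (not of the initial one).
data _—[_]→_ (w : Word) : ℕ → Word → Set where
  click : ∀ us c k vs → groups w ≡ us ++ (c , k) ∷ vs → 2 ≤ k →
          w —[ length us ]→ (blocks us ++ blocks vs)

data Solution : Word → List ℕ → Set where
  done : Solution [] []
  move : ∀ {w i w′ is} → w —[ i ]→ w′ → Solution w′ is → Solution w (i ∷ is)

Solvable : Word → Set
Solvable w = ∃[ is ] Solution w is

-- A group of more than two blocks is equivalent to one of two blocks, and
-- time bounds are measured on the puzzle with groups shortened accordingly.
reduce : List Group → List Group
reduce = map (map₂ (_⊓ 2))

encode : List Group → List ℕ
encode gs = length gs ∷ concatMap (λ (c , k) → toℕ c ∷ k ∷ []) gs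

-- Unit-cost RAM, with the instruction set of Cook and Reckhow, over
-- registers holding natural numbers (so subtraction is truncated).

Register Label : Set
Register = ℕ
Label    = ℕ

data Instruction : Set where
  const : Register → ℕ → Instruction                    -- Xᵢ ← a
  add   : Register → Register → Register → Instruction  -- Xᵢ ← Xⱼ + Xₖ
  sub   : Register → Register → Register → Instruction  -- Xᵢ ← Xⱼ ∸ Xₖ
  load  : Register → Register → Instruction             -- Xᵢ ← X_{Xⱼ}
  store : Register → Register → Instruction             -- X_{Xᵢ} ← Xⱼ
  jpos  : Register → Label → Instruction                -- if Xᵢ > 0 goto ℓ
  read  : Register → Instruction                        -- Xᵢ ← next input
  print : Register → Instruction
  halt  : Instruction

-- Instructions are labelled by their position, counted from 0.
Program : Set
Program = List Instruction

Memory : Set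
Memory = Register → ℕ

_[_≔_] : Memory → Register → ℕ → Memory
(m [ i ≔ a ]) j = if i ≡ᵇ j then a else m j

record State : Set where
  constructor ⟨_,_,_,_⟩
  field
    pc     : Label
    memory : Memory
    input  : List ℕ
    output : List ℕ

open State public

initial : List ℕ → State
initial xs = ⟨ 0 , (λ _ → 0) , xs , [] ⟩

-- Reading past the end of the input yields 0.
execute : Instruction → State → Maybe State
execute (const i a) ⟨ p , m , xs , ys ⟩ = just ⟨ suc p , m [ i ≔ a ] , xs , ys ⟩
execute (add i j k) ⟨ p , m , xs , ys ⟩ = just ⟨ suc p , m [ i ≔ m j + m k ] , xs , ys ⟩
execute (sub i j k) ⟨ p , m , xs , ys ⟩ = just ⟨ suc p , m [ i ≔ m j ∸ m k ] , xs , ys ⟩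
execute (load i j)  ⟨ p , m , xs , ys ⟩ = just ⟨ suc p , m [ i ≔ m (m j) ] , xs , ys ⟩
execute (store i j) ⟨ p , m , xs , ys ⟩ = just ⟨ suc p , m [ m i ≔ m j ] , xs , ys ⟩
execute (jpos i ℓ)  ⟨ p , m , xs , ys ⟩ =
  just ⟨ (if m i ≡ᵇ 0 then suc p else ℓ) , m , xs , ys ⟩
execute (read i)    ⟨ p , m , [] , ys ⟩ = just ⟨ suc p , m [ i ≔ 0 ] , [] , ys ⟩
execute (read i)    ⟨ p , m , x ∷ xs , ys ⟩ = just ⟨ suc p , m [ i ≔ x ] , xs , ys ⟩
execute (print i)   ⟨ p , m , xs , ys ⟩ = just ⟨ suc p , m , xs , ys ∷ʳ m i ⟩
execute halt        _                   = nothing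

-- The result nothing means that the machine has halted, at a halt
-- instruction or by leaving the program.
step : Program → State → Maybe State
step P s with head (drop (pc s) P)
... | just I  = execute I s
... | nothing = nothing

data _⊢_⇓[_]_ (P : Program) : State → ℕ → List ℕ → Set where
  halted : ∀ {s} → step P s ≡ nothing → P ⊢ s ⇓[ 0 ] output s
  next   : ∀ {s s′ t ys} → step P s ≡ just s′ → P ⊢ s′ ⇓[ t ] ys →
           P ⊢ s ⇓[ suc t ] ys

_on_Outputs_Within_ : Program → List ℕ → List ℕ → ℕ → Set
P on xs Outputs ys Within T = ∃[ t ] (t ≤ T × P ⊢ initial xs ⇓[ t ] ys)

{-# OPTIONS --safe #-}

-- Write n = 2m+1 and number the groups from 0. If the median group m is big
-- (of size at least two), clicking the median over and over solves the puzzle,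
-- since each click merges its neighbours into a big group, the new median.
-- Otherwise let p be the last big group before m and r the first one after it.
-- Clicking p, then the merged group at p − 1, and so on moves the median
-- towards r and reaches it after r − m clicks, all of them between two groups
-- if r − p ≤ m. So the clicks p, p − 1, … (r − m of them) and then
-- 2m − r, …, 1, 0 form a solution, which can be printed while the groups are
-- read in order.
-- In a solvable puzzle, a non-empty run of l singletons with a groups before
-- it and b after it satisfies l < a + b, and even 1 + l < a + b if a, b > 0: by
-- induction on the solution, as a click removing two groups shortens the run
-- by at most one. If r − p > m, the run between p and r violates this.
module Submission where

open import Data.Fin using (toℕ; _≟_)
open import Data.Fin.Patterns using (0F; 1F)
open import Data.List using (List; []; _∷_; [_]; _++_; _∷ʳ_; length; replicate; foldr)
open import Data.List using (head; take; drop; downFrom; initLast; _∷ʳ′_)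
open import Data.List.Properties
open import Data.List.Relation.Unary.All using (All; []; _∷_)
open import Data.List.Relation.Unary.All.Properties as All using ()
open import Data.List.Relation.Unary.Linked as Linked using (Linked; []; [-]; _∷_)
open import Data.Maybe using (just; nothing)
open import Data.Nat using (ℕ; zero; suc; _+_; _*_; _∸_; _⊓_; _/_; _≤_; _<_; z≤n; s≤s)
open import Data.Nat.DivMod using (m≡m%n+[m/n]*n)
open import Data.Nat.Properties hiding (_≟_)
open import Data.Nat.Tactic.RingSolver using (solve-∀)
open import Data.Product using (_×_; _,_; proj₁; proj₂; ∃-syntax)
open import Data.Sum using (_⊎_; inj₁; inj₂)
open import Relation.Nullary using (¬_; yes; no; contradiction)
open import Relation.Nullary.Decidable using (dec-true; dec-false)
open import Relation.Binary.PropositionalEquality hiding ([_])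
open import Defs

-- Well-formed group lists and the words they spell.

letter : Group → Letter
letter = proj₁

size : Group → ℕ
size = proj₂

Alternating : List Group → Set
Alternating = Linked (λ g h → letter g ≢ letter h)

WellFormed : List Group → Set
WellFormed gs = Alternating gs × All (λ g → 1 ≤ size g) gs

addBlock-wellFormed : ∀ c {gs} → WellFormed gs → WellFormed (addBlock c gs)
addBlock-wellFormed c ([] , []) = [-] , ≤-refl ∷ []
addBlock-wellFormed c {(d , k) ∷ gs} (alt , pos) with c ≟ d
addBlock-wellFormed c ([-] , p ∷ ps) | yes _ = [-] , m≤n⇒m≤1+n p ∷ ps
addBlock-wellFormed c (d≢ ∷ alt , p ∷ ps) | yes _ = d≢ ∷ alt , m≤n⇒m≤1+n p ∷ ps
addBlock-wellFormed c (alt , pos) | no c≢d = c≢d ∷ alt , ≤-refl ∷ pos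

groups-wellFormed : ∀ w → WellFormed (groups w)
groups-wellFormed []      = [] , []
groups-wellFormed (c ∷ w) = addBlock-wellFormed c (groups-wellFormed w)

blocks-addBlock : ∀ c gs → blocks (addBlock c gs) ≡ c ∷ blocks gs
blocks-addBlock c []             = refl
blocks-addBlock c ((d , k) ∷ gs) with c ≟ d
... | yes refl = refl
... | no _     = refl

blocks-groups : ∀ w → blocks (groups w) ≡ w
blocks-groups []      = refl
blocks-groups (c ∷ w) = trans (blocks-addBlock c (groups w)) (cong (c ∷_) (blocks-groups w))

addBlock-same : ∀ c k gs → addBlock c ((c , k) ∷ gs) ≡ (c , suc k) ∷ gs
addBlock-same c k gs rewrite dec-true (c ≟ c) refl = refl

addBlock-new : ∀ c {k gs} → Alternating ((c , k) ∷ gs) → addBlock c gs ≡ (c , 1) ∷ gs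
addBlock-new c [-] = refl
addBlock-new c {gs = (d , _) ∷ _} (c≢d ∷ _) rewrite dec-false (c ≟ d) c≢d = refl

-- Alternation of `(c , l) ∷ gs` expresses that `gs` does not begin with `c`, so the new blocks
-- cannot fuse with its first group.
addBlocks : ∀ c {l gs} → Alternating ((c , l) ∷ gs) → ∀ k →
            foldr addBlock gs (replicate (suc k) c) ≡ (c , suc k) ∷ gs
addBlocks c alt zero    = addBlock-new c alt
addBlocks c {gs = gs} alt (suc k) =
  trans (cong (addBlock c) (addBlocks c alt k)) (addBlock-same c (suc k) gs)

-- Adjacent groups with different letters cannot fuse, and nonempty ones cannot vanish. Hence clicks
-- can be studied on group lists instead of words.
groups-blocks : ∀ {gs} → WellFormed gs → groups (blocks gs) ≡ gs
groups-blocks {[]} _ = refl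
groups-blocks {(c , suc k) ∷ gs} (alt , _ ∷ pos) = begin
  groups (replicate (suc k) c ++ blocks gs)
    ≡⟨ foldr-++ addBlock [] (replicate (suc k) c) (blocks gs) ⟩
  foldr addBlock (groups (blocks gs)) (replicate (suc k) c)
    ≡⟨ cong (λ hs → foldr addBlock hs (replicate (suc k) c)) (groups-blocks (Linked.tail alt , pos)) ⟩
  foldr addBlock gs (replicate (suc k) c)
    ≡⟨ addBlocks c alt k ⟩
  (c , suc k) ∷ gs ∎
  where open ≡-Reasoning

alternating-++⁻ʳ : ∀ us {vs} → Alternating (us ++ vs) → Alternating vs
alternating-++⁻ʳ []       alt = alt
alternating-++⁻ʳ (_ ∷ us) alt = alternating-++⁻ʳ us (Linked.tail alt)

alternating-++⁻ˡ : ∀ us {vs} → Alternating (us ++ vs) → Alternating us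
alternating-++⁻ˡ []           _         = []
alternating-++⁻ˡ (_ ∷ [])     _         = [-]
alternating-++⁻ˡ (_ ∷ _ ∷ us) (g≢ ∷ alt) = g≢ ∷ alternating-++⁻ˡ (_ ∷ us) alt

wellFormed-++⁻ʳ : ∀ us {vs} → WellFormed (us ++ vs) → WellFormed vs
wellFormed-++⁻ʳ us (alt , pos) = alternating-++⁻ʳ us alt , All.++⁻ʳ us pos

wellFormed-++⁻ˡ : ∀ us {vs} → WellFormed (us ++ vs) → WellFormed us
wellFormed-++⁻ˡ us (alt , pos) = alternating-++⁻ˡ us alt , All.++⁻ˡ us pos

-- Here the two colours enter: the neighbours of a group share their letter, so they merge when it
-- is deleted.
≢-≢⇒≡ : ∀ {c d e : Letter} → c ≢ d → d ≢ e → c ≡ e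
≢-≢⇒≡ {0F} {_}  {0F} _   _   = refl
≢-≢⇒≡ {1F} {_}  {1F} _   _   = refl
≢-≢⇒≡ {0F} {0F} {1F} c≢d _   = contradiction refl c≢d
≢-≢⇒≡ {0F} {1F} {1F} _   d≢e = contradiction refl d≢e
≢-≢⇒≡ {1F} {1F} {0F} c≢d _   = contradiction refl c≢d
≢-≢⇒≡ {1F} {0F} {0F} _   d≢e = contradiction refl d≢e

-- Clicks and merging on group lists.

merge : Group → Group → Group
merge (c , k) (_ , l) = c , k + l

alternating-neighbours : ∀ us {x g y vs} → Alternating (us ++ x ∷ g ∷ y ∷ vs) → letter x ≡ letter y
alternating-neighbours us alt with x≢g ∷ g≢y ∷ _ ← alternating-++⁻ʳ us alt = ≢-≢⇒≡ x≢g g≢y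

merge-alternating : ∀ us {x g y vs} → Alternating (us ++ x ∷ g ∷ y ∷ vs) →
                    Alternating (us ++ merge x y ∷ vs)
merge-alternating [] (_ ∷ _ ∷ [-]) = [-]
merge-alternating [] alt@(_ ∷ _ ∷ y≢z ∷ alt′) =
  subst (_≢ _) (sym (alternating-neighbours [] alt)) y≢z ∷ alt′
merge-alternating (_ ∷ [])     (u≢x ∷ alt) = u≢x ∷ merge-alternating [] alt
merge-alternating (_ ∷ u ∷ us) (u≢v ∷ alt) = u≢v ∷ merge-alternating (u ∷ us) alt

merge-wellFormed : ∀ us {x g y vs} → WellFormed (us ++ x ∷ g ∷ y ∷ vs) →
                   WellFormed (us ++ merge x y ∷ vs)
merge-wellFormed us (alt , pos)
  with pos₁ , px ∷ _ ∷ _ ∷ pos₂ ← All.++⁻ us pos =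
  merge-alternating us alt , All.++⁺ pos₁ (≤-trans px (m≤m+n _ _) ∷ pos₂)

merge-big : ∀ us {x g y vs} → WellFormed (us ++ x ∷ g ∷ y ∷ vs) → 2 ≤ size (merge x y)
merge-big us (_ , pos) with px ∷ _ ∷ py ∷ _ ← All.++⁻ʳ us pos = +-mono-≤ px py

replicate-+ : ∀ k l {c : Letter} → replicate (k + l) c ≡ replicate k c ++ replicate l c
replicate-+ zero    l = refl
replicate-+ (suc k) l = cong (_ ∷_) (replicate-+ k l)

blocks-++ : ∀ us vs → blocks (us ++ vs) ≡ blocks us ++ blocks vs
blocks-++ = concatMap-++ _

blocks-merge : ∀ us x y vs → letter x ≡ letter y →
               blocks (us ∷ʳ x) ++ blocks (y ∷ vs) ≡ blocks (us ++ merge x y ∷ vs)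
blocks-merge us x@(c , k) y@(c , l) vs refl = begin
  blocks (us ∷ʳ x) ++ blocks (y ∷ vs)          ≡⟨ blocks-++ (us ∷ʳ x) (y ∷ vs) ⟨
  blocks (us ∷ʳ x ++ y ∷ vs)                   ≡⟨ cong blocks (∷ʳ-++ us x (y ∷ vs)) ⟩
  blocks (us ++ x ∷ y ∷ vs)                    ≡⟨ blocks-++ us (x ∷ y ∷ vs) ⟩
  blocks us ++ replicate k c ++ replicate l c ++ blocks vs
    ≡⟨ cong (blocks us ++_) (++-assoc (replicate k c) (replicate l c) (blocks vs)) ⟨
  blocks us ++ (replicate k c ++ replicate l c) ++ blocks vs
    ≡⟨ cong (λ z → blocks us ++ z ++ blocks vs) (replicate-+ k l) ⟨
  blocks us ++ blocks (merge x y ∷ vs)         ≡⟨ blocks-++ us (merge x y ∷ vs) ⟨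
  blocks (us ++ merge x y ∷ vs)                ∎
  where open ≡-Reasoning

click-group : ∀ us g {vs is} → WellFormed (us ++ g ∷ vs) → 2 ≤ size g →
              Solution (blocks us ++ blocks vs) is →
              Solution (blocks (us ++ g ∷ vs)) (length us ∷ is)
click-group us (c , k) {vs} wf big = move (click us c k vs (groups-blocks wf) big)

click-inner : ∀ us x g {y vs is} → WellFormed (us ++ x ∷ g ∷ y ∷ vs) → 2 ≤ size g →
              Solution (blocks (us ++ merge x y ∷ vs)) is →
              Solution (blocks (us ++ x ∷ g ∷ y ∷ vs)) (suc (length us) ∷ is)
click-inner us x g {y} {vs} {is} wf big sol =
  subst₂ (λ hs i → Solution (blocks hs) (i ∷ is)) (∷ʳ-++ us x (g ∷ y ∷ vs)) (length-++-comm us [ x ])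
    (click-group (us ∷ʳ x) g (subst WellFormed (sym (∷ʳ-++ us x (g ∷ y ∷ vs))) wf) big
      (subst (λ w → Solution w is)
        (sym (blocks-merge us x y vs (alternating-neighbours us (proj₁ wf)))) sol))

-- Solutions built by clicking towards the median.

median-clicks : ∀ n us g vs → length us ≡ n → length vs ≡ n →
                WellFormed (us ++ g ∷ vs) → 2 ≤ size g →
                Solution (blocks (us ++ g ∷ vs)) (downFrom (suc n))
median-clicks zero [] g [] _ _ wf big = click-group [] g wf big done
median-clicks (suc n) us g (y ∷ vs) lu lv wf big with initLast us
... | us′ ∷ʳ′ x =
  -- The neighbours at positions `n` and `n + 2` merge into a group at position `n`, again with
  -- equally many groups on both sides.
  subst₂ (λ hs k → Solution (blocks hs) (k ∷ downFrom (suc n)))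
    (sym (∷ʳ-++ us′ x (g ∷ y ∷ vs))) (cong suc lu′)
    (click-inner us′ x g wf′ big
      (median-clicks n us′ (merge x y) vs lu′ (suc-injective lv)
        (merge-wellFormed us′ wf′) (merge-big us′ wf′)))
  where
  lu′ : length us′ ≡ n
  lu′ = suc-injective (trans (sym (length-++-comm us′ [ x ])) lu)
  wf′ : WellFormed (us′ ++ x ∷ g ∷ y ∷ vs)
  wf′ = subst WellFormed (∷ʳ-++ us′ x (g ∷ y ∷ vs)) wf

-- The positions `k + a`, ..., `1 + a` of a group that `k` clicks move left to position `a`.
descend : ℕ → ℕ → List ℕ
descend zero    a = []
descend (suc k) a = suc k + a ∷ descend k a

-- Each click on p brings the merged group, again of size at least two, one
-- step left and q one step closer to the median, which q is after k clicks.
shifting-clicks : ∀ k {a b} us p vs q ws →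
  length us ≡ k + a → length vs ≡ k + b → length ws ≡ suc (a + b) →
  WellFormed (us ++ p ∷ vs ++ q ∷ ws) → 2 ≤ size p → 2 ≤ size q →
  Solution (blocks (us ++ p ∷ vs ++ q ∷ ws)) (descend k a ++ downFrom (suc (length ws)))
shifting-clicks zero {a} {b} us p vs q ws lu lv lw wf bigp bigq =
  subst (λ hs → Solution (blocks hs) (downFrom (suc (length ws)))) (++-assoc us (p ∷ vs) (q ∷ ws))
    (median-clicks (length ws) (us ++ p ∷ vs) q ws eq refl
      (subst WellFormed (sym (++-assoc us (p ∷ vs) (q ∷ ws))) wf) bigq)
  where
  open ≡-Reasoning
  eq : length (us ++ p ∷ vs) ≡ length ws
  eq = begin
    length (us ++ p ∷ vs)       ≡⟨ length-++ us ⟩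
    length us + suc (length vs) ≡⟨ cong₂ (λ i j → i + suc j) lu lv ⟩
    a + suc b                   ≡⟨ +-suc a b ⟩
    suc (a + b)                 ≡⟨ lw ⟨
    length ws                   ∎
shifting-clicks (suc k) {a} us p (y ∷ vs) q ws lu lv lw wf bigp bigq with initLast us
... | us′ ∷ʳ′ x =
  subst₂ (λ hs i → Solution (blocks hs) (i ∷ descend k a ++ downFrom (suc (length ws))))
    (sym (∷ʳ-++ us′ x (p ∷ y ∷ vs ++ q ∷ ws))) (cong suc lu′)
    (click-inner us′ x p wf′ bigp
      (shifting-clicks k us′ (merge x y) vs q ws lu′ (suc-injective lv) lw
        (merge-wellFormed us′ wf′) (merge-big us′ wf′) bigq))
  where
  lu′ : length us′ ≡ k + a
  lu′ = suc-injective (trans (sym (length-++-comm us′ [ x ])) lu)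
  wf′ : WellFormed (us′ ++ x ∷ p ∷ y ∷ vs ++ q ∷ ws)
  wf′ = subst WellFormed (∷ʳ-++ us′ x (p ∷ y ∷ vs ++ q ∷ ws)) wf

-- A necessary condition: room around runs of singletons.

Single : Group → Set
Single g = size g ≡ 1

-- There are `a` groups before a run of length `l` and `b` after it. `between` covers `l = 0` too,
-- which the induction needs when a click shortens a run of one singleton to nothing.
record Room (a l b : ℕ) : Set where
  constructor room
  field
    beside  : 1 ≤ l → suc l ≤ a + b
    between : 1 ≤ a → 1 ≤ b → 2 + l ≤ a + b

open Room

room-comm : ∀ {a l b} → Room a l b → Room b l a
room-comm {a} {b = b} r = room
  (λ pl → ≤-trans (beside r pl) (≤-reflexive (+-comm a b)))
  (λ pb pa → ≤-trans (between r pa pb) (≤-reflexive (+-comm a b)))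

room-empty : ∀ {a b} → Room a 0 b
room-empty = room (λ ()) +-mono-≤

-- The old `beside` yields the new `between`, as their bounds differ by one; so a run at the start
-- of the puzzle may gain its first neighbour.
room-sucˡ : ∀ {a l b} → Room a l b → Room (suc a) l b
room-sucˡ {l = zero}  r = room-empty
room-sucˡ {l = suc l} r = room (λ pl → m≤n⇒m≤1+n (beside r pl)) (λ _ _ → s≤s (beside r (s≤s z≤n)))

-- This undoes a click next to the run: the merged group splits into a group farther out and a
-- singleton of the run, with the clicked group between them.
room-absorbˡ : ∀ {a l b} → Room (suc a) l b → Room (2 + a) (suc l) b
room-absorbˡ {l = zero}  r = room (λ _ → s≤s (s≤s z≤n)) (λ _ pb → s≤s (between r (s≤s z≤n) pb))
room-absorbˡ {l = suc l} r =
  room (λ _ → s≤s (beside r (s≤s z≤n))) (λ _ pb → s≤s (between r (s≤s z≤n) pb))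

-- Runs may be empty or not maximal, so the induction can pass to what a click leaves of a run.
Roomy : List Group → Set
Roomy gs = ∀ us ss vs → gs ≡ us ++ ss ++ vs → All Single ss → Room (length us) (length ss) (length vs)

-- Collapse us vs gs: clicking the group between us and vs leaves gs.
data Collapse : (us vs gs : List Group) → Set where
  atStart : ∀ {vs} → Collapse [] vs vs
  atEnd   : ∀ {us} → Collapse us [] us
  inner   : ∀ us x y vs → Collapse (us ∷ʳ x) (y ∷ vs) (us ++ merge x y ∷ vs)

groups-click : ∀ us g vs → WellFormed (us ++ g ∷ vs) → Collapse us vs (groups (blocks us ++ blocks vs))
groups-click us g [] wf =
  subst (Collapse us [])
    (sym (trans (cong groups (++-identityʳ (blocks us))) (groups-blocks (wellFormed-++⁻ˡ us wf)))) atEnd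
groups-click us g (y ∷ vs) wf with initLast us
... | [] = subst (Collapse [] (y ∷ vs)) (sym (groups-blocks (wellFormed-++⁻ʳ [ g ] wf))) atStart
... | us′ ∷ʳ′ x =
  subst (Collapse (us′ ∷ʳ x) (y ∷ vs))
    (sym (trans (cong groups (blocks-merge us′ x y vs (alternating-neighbours us′ (proj₁ wf′))))
                (groups-blocks (merge-wellFormed us′ wf′))))
    (inner us′ x y vs)
  where
  wf′ : WellFormed (us′ ++ x ∷ g ∷ y ∷ vs)
  wf′ = subst WellFormed (∷ʳ-++ us′ x (g ∷ y ∷ vs)) wf

length-∷ʳ-++-∷ : ∀ us (x g : Group) ts → length (us ∷ʳ x ++ g ∷ ts) ≡ 2 + length (us ++ ts)
length-∷ʳ-++-∷ us x g ts = begin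
  length (us ∷ʳ x ++ g ∷ ts)  ≡⟨ cong length (∷ʳ-++ us x (g ∷ ts)) ⟩
  length (us ++ x ∷ g ∷ ts)   ≡⟨ length-++-sucʳ us x (g ∷ ts) ⟩
  suc (length (us ++ g ∷ ts)) ≡⟨ cong suc (length-++-sucʳ us g ts) ⟩
  2 + length (us ++ ts)       ∎
  where open ≡-Reasoning

++-assoc₃ : ∀ (us vs ws xs : List Group) → (us ++ vs ++ ws) ++ xs ≡ us ++ vs ++ ws ++ xs
++-assoc₃ us vs ws xs = trans (++-assoc us (vs ++ ws) xs) (cong (us ++_) (++-assoc vs ws xs))

-- The run lies to the right of the clicked group. Either the run stays intact and one or two groups
-- before it disappear, or its first singleton is absorbed by the merge.
room-after : ∀ {us vs gs} g ts ss ws → Collapse us vs gs → Roomy gs → vs ≡ ts ++ ss ++ ws → All Single ss →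
             Room (length (us ++ g ∷ ts)) (length ss) (length ws)
room-after g ts ss ws atStart roomy eq single = room-sucˡ (roomy ts ss ws eq single)
room-after g [] [] ws atEnd roomy eq single = room-empty
room-after g (y ∷ ts) ss ws (inner us x _ _) roomy refl single
  rewrite length-∷ʳ-++-∷ us x g (y ∷ ts) | length-++-sucʳ us y ts =
  room-sucˡ (room-sucˡ (subst (λ a → Room a _ _) (length-++-sucʳ us z ts)
    (roomy (us ++ z ∷ ts) ss ws (sym (++-assoc us (z ∷ ts) (ss ++ ws))) single)))
  where z = merge x y
room-after g [] [] ws (inner _ _ _ _) roomy eq single = room-empty
room-after g [] (y ∷ ss) ws (inner us x _ _) roomy refl (_ ∷ single)
  rewrite length-∷ʳ-++-∷ us x g [] =
  room-absorbˡ (subst (λ a → Room a _ _) (length-++-sucʳ us z [])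
    (roomy (us ∷ʳ z) ss ws (sym (∷ʳ-++ us z (ss ++ ws))) single))
  where z = merge x y

-- The mirror image of `room-after`, with `room-comm` exchanging the sides.
room-before : ∀ {us vs gs} g ws ss ts → Collapse us vs gs → Roomy gs → us ≡ ws ++ ss ++ ts → All Single ss →
              Room (length ws) (length ss) (length (ts ++ g ∷ vs))
room-before g [] [] ts atStart roomy eq single = room-empty
room-before g ws ss ts atEnd roomy eq single
  rewrite length-++-comm ts [ g ] = room-comm (room-sucˡ (room-comm (roomy ws ss ts eq single)))
-- The merging neighbour `x` is the last group of `us`: it lies in `ts` if that is nonempty, and
-- otherwise ends the run.
room-before g ws ss ts (inner us x y vs) roomy eq single with initLast ts
... | ts′ ∷ʳ′ t
  rewrite length-∷ʳ-++-∷ ts′ t g (y ∷ vs) | length-++-sucʳ ts′ y vs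
        | ∷ʳ-injectiveˡ us (ws ++ ss ++ ts′) (trans eq (sym (++-assoc₃ ws ss ts′ [ t ]))) =
  room-comm (room-sucˡ (room-sucˡ (room-comm (subst (Room _ _) (length-++-sucʳ ts′ z vs)
    (roomy ws ss (ts′ ++ z ∷ vs) (++-assoc₃ ws ss ts′ (z ∷ vs)) single)))))
  where z = merge x y
... | [] with initLast ss
... | [] = room-empty
... | ss′ ∷ʳ′ s
  rewrite length-++-comm ss′ [ s ]
        | ∷ʳ-injectiveˡ us (ws ++ ss′)
            (trans eq (trans (cong (ws ++_) (++-identityʳ (ss′ ∷ʳ s))) (sym (++-assoc ws ss′ [ s ])))) =
  room-comm (room-absorbˡ (room-comm
    (roomy ws ss′ (merge x y ∷ vs) (++-assoc ws ss′ (merge x y ∷ vs)) (All.++⁻ˡ ss′ single))))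

++-splits : ∀ {g : Group} us {vs} ws {xs} → us ++ g ∷ vs ≡ ws ++ xs →
            (∃[ ts ] ws ≡ us ++ g ∷ ts × vs ≡ ts ++ xs) ⊎
            (∃[ ts ] us ≡ ws ++ ts × xs ≡ ts ++ g ∷ vs)
++-splits us       []       eq = inj₂ (us , refl , sym eq)
++-splits []       (w ∷ ws) refl = inj₁ (ws , refl , refl)
++-splits (u ∷ us) (w ∷ ws) eq with refl , eq′ ← ∷-injective eq with ++-splits us ws eq′
... | inj₁ (ts , refl , eq″) = inj₁ (ts , refl , eq″)
... | inj₂ (ts , refl , eq″) = inj₂ (ts , refl , eq″)

roomy-unclick : ∀ us g vs {gs} → 2 ≤ size g → Collapse us vs gs → Roomy gs → Roomy (us ++ g ∷ vs)
roomy-unclick us g vs big collapse roomy ws ss xs eq single with ++-splits us ws eq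
... | inj₁ (ts , refl , eq′) = room-after g ts ss xs collapse roomy eq′ single
... | inj₂ (ts , us≡ , eq′) with ++-splits ts ss (sym eq′)
...   | inj₁ (_ , refl , _) with All.++⁻ʳ ts single
-- A clicked group has size at least two, so it cannot belong to the run.
...     | s ∷ _ = contradiction (subst (2 ≤_) s big) λ { (s≤s ()) }
roomy-unclick us g vs big collapse roomy ws ss xs eq single | inj₂ (ts , us≡ , eq′) | inj₂ (rs , refl , refl) =
  room-before g ws ss rs collapse roomy us≡ single

solution-roomy : ∀ {w is} → Solution w is → Roomy (groups w)
solution-roomy done [] [] [] _ _ = room-empty
solution-roomy {w} (move (click us c k vs eq big) sol) =
  subst Roomy (sym eq)
    (roomy-unclick us (c , k) vs big
      (groups-click us (c , k) vs (subst WellFormed eq (groups-wellFormed w))) (solution-roomy sol))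

-- The programs.

-- X₀ counts down the input by twos, X₁ = 1, X₂ is the number of groups read,
-- X₃ the position of the last of them of size at least two, X₄ scratch, X₅ = 0.
-- It is left for label 14 when half of the groups have been read.
scanHalf : Program
scanHalf =
    const 1 1     --  0
  ∷ read 0
  ∷ sub 0 0 1     --  2
  ∷ jpos 0 5
  ∷ jpos 1 14
  ∷ sub 0 0 1     --  5
  ∷ read 4
  ∷ read 4
  ∷ sub 4 4 1
  ∷ jpos 4 12
  ∷ add 2 2 1     -- 10
  ∷ jpos 1 2
  ∷ add 3 2 5     -- 12
  ∷ jpos 1 10
  ∷ []

-- X₃ counts down the candidates m, …, m + p for r.
searchAndDecide : Program
searchAndDecide =
    read 4        -- 14
  ∷ read 4
  ∷ sub 4 4 1
  ∷ jpos 4 23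
  ∷ jpos 3 21
  ∷ print 5
  ∷ halt
  ∷ sub 3 3 1     -- 21
  ∷ jpos 1 14
  ∷ print 1       -- 23
  ∷ halt
  ∷ []

-- Every group rejected as r costs one click left of the median, printed at
-- once; X₂ follows the median, which is r when the search ends.
searchAndSolve : Program
searchAndSolve =
    read 4        -- 14
  ∷ read 4
  ∷ sub 4 4 1
  ∷ jpos 4 22
  ∷ print 3
  ∷ sub 3 3 1
  ∷ sub 2 2 1
  ∷ jpos 1 14
  ∷ print 2       -- 22
  ∷ jpos 2 25
  ∷ halt
  ∷ sub 2 2 1     -- 25
  ∷ jpos 1 22
  ∷ []

decider : Program
decider = scanHalf ++ searchAndDecide

solver : Program
solver = scanHalf ++ searchAndSolve

-- Runs with a bound on the number of steps.

_⊢_⇓≤[_]_ : Program → State → ℕ → List ℕ → Set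
P ⊢ s ⇓≤[ T ] ys = ∃[ t ] (t ≤ T × P ⊢ s ⇓[ t ] ys)

stop : ∀ {P s ys} → step P s ≡ nothing → output s ≡ ys → P ⊢ s ⇓≤[ 0 ] ys
stop eq refl = 0 , z≤n , halted eq

then : ∀ {P s s′ T ys} → step P s ≡ just s′ → P ⊢ s′ ⇓≤[ T ] ys → P ⊢ s ⇓≤[ suc T ] ys
then eq (t , t≤T , run) = suc t , s≤s t≤T , next eq run

within : ∀ {P s S T ys} → S ≤ T → P ⊢ s ⇓≤[ S ] ys → P ⊢ s ⇓≤[ T ] ys
within S≤T (t , t≤S , run) = t , ≤-trans t≤S S≤T , run

module _ {P : Program} {p i ℓ : ℕ} (here : head (drop p P) ≡ just (jpos i ℓ))
         {m : Memory} {xs ys : List ℕ} {T : ℕ} {zs : List ℕ} where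

  -- A jump needs a proof about the tested register before its successor state is known; the steps
  -- of the other instructions hold by `refl`.
  step-jpos : step P ⟨ p , m , xs , ys ⟩ ≡ execute (jpos i ℓ) ⟨ p , m , xs , ys ⟩
  step-jpos rewrite here = refl

  jump : ∀ {a} → m i ≡ suc a → P ⊢ ⟨ ℓ , m , xs , ys ⟩ ⇓≤[ T ] zs →
         P ⊢ ⟨ p , m , xs , ys ⟩ ⇓≤[ suc T ] zs
  jump eq = then (trans step-jpos jumps)
    where
    jumps : execute (jpos i ℓ) ⟨ p , m , xs , ys ⟩ ≡ just ⟨ ℓ , m , xs , ys ⟩
    jumps rewrite eq = refl

  pass : m i ≡ 0 → P ⊢ ⟨ suc p , m , xs , ys ⟩ ⇓≤[ T ] zs →
         P ⊢ ⟨ p , m , xs , ys ⟩ ⇓≤[ suc T ] zs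
  pass eq = then (trans step-jpos passes)
    where
    passes : execute (jpos i ℓ) ⟨ p , m , xs , ys ⟩ ≡ just ⟨ suc p , m , xs , ys ⟩
    passes rewrite eq = refl

-- Correctness of the scan of the first half.

tape : List Group → List ℕ
tape gs = drop 1 (encode (reduce gs))

single-or-big : ∀ g → 1 ≤ size g → Single g ⊎ 2 ≤ size g
single-or-big (_ , suc zero)    _ = inj₁ refl
single-or-big (_ , suc (suc _)) _ = inj₂ (s≤s (s≤s z≤n))

-- The value 0 for a list without big groups leaves the search only the
-- median itself to find.
data LastBig : List Group → ℕ → Set where
  none : ∀ {gs} → All Single gs → LastBig gs 0
  at   : ∀ us {g vs} → 2 ≤ size g → All Single vs → LastBig (us ++ g ∷ vs) (length us)

lastBig-∷ʳ-single : ∀ {gs p g} → Single g → LastBig gs p → LastBig (gs ∷ʳ g) p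
lastBig-∷ʳ-single sg (none singles)      = none (All.++⁺ singles (sg ∷ []))
lastBig-∷ʳ-single sg (at us {g} {vs} big singles) =
  subst (λ hs → LastBig hs (length us)) (sym (++-assoc us (g ∷ vs) _)) (at us big (All.++⁺ singles (sg ∷ [])))

lastBig-≤ : ∀ {gs p} → LastBig gs p → p ≤ length gs
lastBig-≤ (none _)   = z≤n
lastBig-≤ (at us _ _) = length-++-≤ˡ us

-- An invariant shared by the scan and both searches. X₀ matters to the scan alone and is treated
-- there; X₄ is scratch.
record Scanned (m : Memory) (i p : ℕ) : Set where
  field
    one    : m 1 ≡ 1
    index  : m 2 ≡ i
    recent : m 3 ≡ p
    null   : m 5 ≡ 0

size∸1-single : ∀ g {a} → Single g → a ≡ 1 → (size g ⊓ 2) ∸ a ≡ 0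
size∸1-single g single one = cong₂ (λ k a → (k ⊓ 2) ∸ a) single one

size∸1-big : ∀ g {a} → 2 ≤ size g → a ≡ 1 → (size g ⊓ 2) ∸ a ≡ 1
size∸1-big g big one = cong₂ _∸_ (m≥n⇒m⊓n≡n big) one

-- `rs` has been read and `us` is still to be scanned. Prolonging an arbitrary run from label 14
-- makes the result usable for both programs. A group costs at most 11 steps, leaving the loop 3.
scanHalf-loop : ∀ {Q} rs us vs {p m ys} →
  All (λ g → 1 ≤ size g) us → LastBig rs p → m 0 ≡ suc (length us * 2) → Scanned m (length rs) p →
  ∃[ q ] ∃[ m′ ] LastBig (rs ++ us) q × Scanned m′ (length (rs ++ us)) q ×
    (∀ {T zs} → (scanHalf ++ Q) ⊢ ⟨ 14 , m′ , tape vs , ys ⟩ ⇓≤[ T ] zs →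
                (scanHalf ++ Q) ⊢ ⟨ 2 , m , tape (us ++ vs) , ys ⟩ ⇓≤[ length us * 11 + 3 + T ] zs)
scanHalf-loop rs [] vs _ lb m₀ sc rewrite ++-identityʳ rs =
  _ , _ , lb , record { Scanned sc } , λ run →
    then refl (pass refl (cong₂ _∸_ m₀ one) (jump refl one run))
  where open Scanned sc
scanHalf-loop {Q} rs (g ∷ us) vs {p} {m} {ys} (pg ∷ pos) lb m₀ sc
  rewrite sym (∷ʳ-++ rs g us) = case (single-or-big g pg)
  where
  open Scanned sc
  counter : m 0 ∸ m 1 ∸ m 1 ≡ suc (length us * 2)
  counter = cong₂ (λ a b → a ∸ b ∸ b) m₀ one
  incremented : m 2 + m 1 ≡ length (rs ∷ʳ g)
  incremented = trans (cong₂ _+_ index one) (sym (length-++ rs))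
  m″ = (((m [ 0 ≔ m 0 ∸ m 1 ]) [ 0 ≔ m 0 ∸ m 1 ∸ m 1 ]) [ 4 ≔ toℕ (letter g) ]) [ 4 ≔ size g ⊓ 2 ]
  read-group : ∀ {T zs} →
    (scanHalf ++ Q) ⊢ ⟨ 9 , m″ [ 4 ≔ (size g ⊓ 2) ∸ m 1 ] , tape (us ++ vs) , ys ⟩ ⇓≤[ T ] zs →
    (scanHalf ++ Q) ⊢ ⟨ 2 , m , tape (g ∷ us ++ vs) , ys ⟩ ⇓≤[ 6 + T ] zs
  read-group run = then refl (jump refl (cong₂ _∸_ m₀ one) (then refl (then refl (then refl (then refl run)))))
  case : Single g ⊎ 2 ≤ size g →
    ∃[ q ] ∃[ m′ ] LastBig (rs ∷ʳ g ++ us) q × Scanned m′ (length (rs ∷ʳ g ++ us)) q ×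
    (∀ {T zs} → (scanHalf ++ Q) ⊢ ⟨ 14 , m′ , tape vs , ys ⟩ ⇓≤[ T ] zs →
      (scanHalf ++ Q) ⊢ ⟨ 2 , m , tape (g ∷ us ++ vs) , ys ⟩ ⇓≤[ 11 + (length us * 11 + 3) + T ] zs)
  case (inj₁ sg) =
    let q , m′ , lb′ , sc′ , rest =
          scanHalf-loop (rs ∷ʳ g) us vs pos (lastBig-∷ʳ-single sg lb) counter
            (record { one = one ; index = incremented ; recent = recent ; null = null })
    -- A singleton takes 9 steps, two fewer than a big group, since X₃ is not updated.
    in q , m′ , lb′ , sc′ , λ run → read-group (within (m≤n+m _ 2)
      (pass refl (size∸1-single g sg one) (then refl (jump refl one (rest run)))))
  case (inj₂ big) =
    let q , m′ , lb′ , sc′ , rest =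
          scanHalf-loop (rs ∷ʳ g) us vs pos (at rs big []) counter
            (record { one = one ; index = incremented
                    ; recent = trans (cong₂ _+_ index null) (+-identityʳ _) ; null = null })
    in q , m′ , lb′ , sc′ , λ run → read-group
      (jump refl (size∸1-big g big one) (then refl (jump refl one (then refl (jump refl one (rest run))))))

scanHalf-correct : ∀ {Q} us vs → All (λ g → 1 ≤ size g) us → length vs ≡ suc (length us) →
  ∃[ p ] ∃[ m ] LastBig us p × Scanned m (length us) p ×
    (∀ {T zs} → (scanHalf ++ Q) ⊢ ⟨ 14 , m , tape vs , [] ⟩ ⇓≤[ T ] zs →
      (scanHalf ++ Q) ⊢ initial (encode (reduce (us ++ vs))) ⇓≤[ 5 + (length us * 11 + T) ] zs)
scanHalf-correct us vs pos lv =
  let p , m , lb , sc , rest =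
        scanHalf-loop [] us vs pos (none []) counter
          (record { one = refl ; index = refl ; recent = refl ; null = refl })
  in p , m , lb , sc , λ {T} run →
    within (≤-reflexive (solve (length us) T)) (then refl (then refl (rest run)))
  where
  solve : ∀ h T → 2 + (h * 11 + 3 + T) ≡ 5 + (h * 11 + T)
  solve = solve-∀
  odd : ∀ h → h + suc h ≡ suc (h * 2)
  odd = solve-∀
  counter : length (reduce (us ++ vs)) ≡ suc (length us * 2)
  counter = trans (length-map _ (us ++ vs))
    (trans (length-++ us) (trans (cong (length us +_) lv) (odd (length us))))

-- Correctness of the two searches.

decider-found : ∀ us g vs {a m i} → All Single us → 2 ≤ size g → Scanned m i (length us + a) →
  decider ⊢ ⟨ 14 , m , tape (us ++ g ∷ vs) , [] ⟩ ⇓≤[ length us * 7 + 5 ] (1 ∷ [])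
decider-found [] g vs {m = m} _ big sc =
  then refl (then refl (then refl (jump refl (size∸1-big g big one) (then refl (stop refl (cong [_] one))))))
  where open Scanned sc
decider-found (u ∷ us) g vs {m = m} (su ∷ singles) big sc =
  -- X₃ holds `suc (length us + a)`, so a further candidate remains.
  then refl (then refl (then refl (pass refl (size∸1-single u su one) (jump refl recent
    (then refl (jump refl one (decider-found us g vs singles big
      (record { one = one ; index = index ; recent = cong₂ _∸_ recent one ; null = null }))))))))
  where open Scanned sc

-- The counter is tested after a candidate is rejected, so a counter of `p` admits `p + 1`
-- candidates.
decider-missed : ∀ us vs {p m i} → All Single us → length us ≡ suc p → Scanned m i p →
  decider ⊢ ⟨ 14 , m , tape (us ++ vs) , [] ⟩ ⇓≤[ p * 7 + 6 ] (0 ∷ [])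
decider-missed (u ∷ []) vs {m = m} (su ∷ []) refl sc =
  then refl (then refl (then refl (pass refl (size∸1-single u su one) (pass refl recent (then refl
    (stop refl (cong [_] null)))))))
  where open Scanned sc
decider-missed (u ∷ us@(_ ∷ _)) vs {m = m} (su ∷ singles) refl sc =
  then refl (then refl (then refl (pass refl (size∸1-single u su one) (jump refl recent
    (then refl (jump refl one (decider-missed us vs singles refl
      (record { one = one ; index = index ; recent = cong₂ _∸_ recent one ; null = null }))))))))
  where open Scanned sc

solver-countdown : ∀ i {m xs ys} → m 1 ≡ 1 → m 2 ≡ i →
  solver ⊢ ⟨ 22 , m , xs , ys ⟩ ⇓≤[ i * 4 + 2 ] (ys ++ downFrom (suc i))
solver-countdown zero {m} {ys = ys} one index =
  then refl (pass refl index (stop refl (cong (ys ∷ʳ_) index)))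
solver-countdown (suc i) {m} {xs} {ys} one index =
  subst (λ zs → solver ⊢ ⟨ 22 , m , xs , ys ⟩ ⇓≤[ suc i * 4 + 2 ] zs)
    (trans (∷ʳ-++ ys (m 2) _) (cong (λ j → ys ++ j ∷ downFrom (suc i)) index))
    (then refl (jump refl index (then refl (jump refl one
      (solver-countdown i one (cong₂ _∸_ index one))))))

-- X₂ starts at the position of the median. Each printed click removes two groups and lowers it by
-- one, until it equals the number `length vs` of groups after `g`, which is then the median.
solver-found : ∀ us g vs {a m ys} → All Single us → 2 ≤ size g → Scanned m (length us + length vs) (length us + a) →
  solver ⊢ ⟨ 14 , m , tape (us ++ g ∷ vs) , ys ⟩
    ⇓≤[ length us * 8 + (4 + (length vs * 4 + 2)) ] (ys ++ descend (length us) a ++ downFrom (suc (length vs)))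
solver-found [] g vs {m = m} _ big sc =
  then refl (then refl (then refl (jump refl (size∸1-big g big one) (solver-countdown (length vs) one index))))
  where open Scanned sc
solver-found (u ∷ us) g vs {a} {m} {ys} (su ∷ singles) big sc =
  subst (λ zs → solver ⊢ ⟨ 14 , m , tape (u ∷ us ++ g ∷ vs) , ys ⟩ ⇓≤[ _ ] zs)
    (trans (∷ʳ-++ ys (m 3) _) (cong (λ j → ys ++ j ∷ descend (length us) a ++ downFrom (suc (length vs))) recent))
    (then refl (then refl (then refl (pass refl (size∸1-single u su one)
      (then refl (then refl (then refl (jump refl one (solver-found us g vs singles big
        (record { one = one ; index = cong₂ _∸_ index one ; recent = cong₂ _∸_ recent one ; null = null }))))))))))
  where open Scanned sc

-- What the outcome of the search says about the puzzle.

data Search : List Group → ℕ → Set where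
  found  : ∀ us g vs a → All Single us → 2 ≤ size g → Search (us ++ g ∷ vs) (length us + a)
  missed : ∀ us vs {p} → All Single us → length us ≡ suc p → Search (us ++ vs) p

-- Offsets `0` to `p` are examined, and `p < length gs` keeps the list from running out first. In
-- `found`, the slack `a` is the position that the last big group before the median will reach.
search : ∀ gs p → All (λ g → 1 ≤ size g) gs → p < length gs → Search gs p
search (g ∷ gs) p (pg ∷ pos) p< with single-or-big g pg
search (g ∷ gs) p       (pg ∷ pos) p<       | inj₂ big = found [] g gs p [] big
search (g ∷ gs) zero    (pg ∷ pos) p<       | inj₁ sg = missed [ g ] gs (sg ∷ []) refl
search (g ∷ gs) (suc p) (pg ∷ pos) (s≤s p<) | inj₁ sg with search gs p pos p<
... | found us h vs a singles big = found (g ∷ us) h vs a (sg ∷ singles) big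
... | missed us vs singles lu     = missed (g ∷ us) vs (sg ∷ singles) (cong suc lu)

-- The median is the first group of `vs`.
data Halves : List Group → Set where
  halves : ∀ us vs → length vs ≡ suc (length us) → Halves (us ++ vs)

halve : ∀ gs → Odd (length gs) → Halves gs
halve gs odd = subst Halves (take++drop≡id h gs) (halves (take h gs) (drop h gs) (begin
  length (drop h gs)            ≡⟨ length-drop h gs ⟩
  length gs ∸ h                 ≡⟨ cong (_∸ h) eq ⟩
  suc (h + h) ∸ h               ≡⟨ m+n∸n≡m (suc h) h ⟩
  suc h                         ≡⟨ cong suc (m≤n⇒m⊓n≡m h≤) ⟨
  suc (h ⊓ length gs)           ≡⟨ cong suc (length-take h gs) ⟨
  suc (length (take h gs))      ∎))
  where
  open ≡-Reasoning
  h = length gs / 2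
  eq : length gs ≡ suc (h + h)
  eq = trans (m≡m%n+[m/n]*n (length gs) 2) (trans (cong (_+ h * 2) odd) (cong suc (solve h)))
    where
    solve : ∀ h → h * 2 ≡ h + h
    solve = solve-∀
  h≤ : h ≤ length gs
  h≤ = ≤-trans (m≤n⇒m≤1+n (m≤m+n h h)) (≤-reflexive (sym eq))

-- If `vs` is empty, the median itself is big. Otherwise `p` is positive, which excludes `none`, and
-- the big group at `p` can be shifted `length vs` times.
found-solution : ∀ {us p} vs g ws a → LastBig us p → p ≡ length vs + a →
  length (vs ++ g ∷ ws) ≡ suc (length us) → 2 ≤ size g → WellFormed (us ++ vs ++ g ∷ ws) →
  Solution (blocks (us ++ vs ++ g ∷ ws)) (descend (length vs) a ++ downFrom (suc (length ws)))
found-solution {us} [] g ws a lb p≡ lv big wf =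
  median-clicks (length ws) us g ws (sym (suc-injective lv)) refl wf big
found-solution vs@(_ ∷ _) g ws a (at us {h} {ts} bigh _) p≡ lv big wf =
  subst (λ gs → Solution (blocks gs) _) (sym regroup)
    (shifting-clicks (length vs) us h (ts ++ vs) g ws p≡
      (trans (length-++ ts) (+-comm (length ts) (length vs))) lw
      (subst WellFormed regroup wf) bigh big)
  where
  regroup : (us ++ h ∷ ts) ++ vs ++ g ∷ ws ≡ us ++ h ∷ (ts ++ vs) ++ g ∷ ws
  regroup = trans (++-assoc us (h ∷ ts) (vs ++ g ∷ ws))
                  (cong (λ z → us ++ h ∷ z) (sym (++-assoc ts vs (g ∷ ws))))
  lw : length ws ≡ suc (a + length ts)
  lw = +-cancelˡ-≡ (length vs) (length ws) (suc (a + length ts)) (suc-injective (begin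
    suc (length vs + length ws)               ≡⟨ +-suc (length vs) (length ws) ⟨
    length vs + suc (length ws)               ≡⟨ length-++ vs ⟨
    length (vs ++ g ∷ ws)                     ≡⟨ lv ⟩
    suc (length (us ++ h ∷ ts))               ≡⟨ cong suc (length-++ us) ⟩
    suc (length us + suc (length ts))         ≡⟨ cong (λ i → suc (i + suc (length ts))) p≡ ⟩
    suc (length vs + a + suc (length ts))     ≡⟨ solve (length vs) a (length ts) ⟩
    suc (length vs + suc (a + length ts))     ∎))
    where
    open ≡-Reasoning
    solve : ∀ v a t → suc (v + a + suc t) ≡ suc (v + suc (a + t))
    solve = solve-∀

-- Without a big group in `us`, the run `us ++ vs` is longer than `ws`, contradicting `beside`.
-- Otherwise the run `ts ++ vs` after the big group `h` violates `between` by exactly one.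
missed-unroomy : ∀ {us p} vs ws → LastBig us p → All Single vs → length vs ≡ suc p →
  length (vs ++ ws) ≡ suc (length us) → ¬ Roomy (us ++ vs ++ ws)
missed-unroomy {us} vs ws (none singles) single lv l roomy =
  1+n≰n (≤-trans (n≤1+n _) (subst₂ _≤_ (cong suc lss) lws
    (Room.beside (roomy [] (us ++ vs) ws (sym (++-assoc us vs ws)) (All.++⁺ singles single))
      (subst (1 ≤_) (sym lss) (s≤s z≤n)))))
  where
  lss : length (us ++ vs) ≡ suc (length us)
  lss = trans (length-++ us) (trans (cong (length us +_) lv) (+-comm (length us) 1))
  lws : length ws ≡ length us
  lws = suc-injective (trans (cong (_+ length ws) (sym lv)) (trans (sym (length-++ vs)) l))
missed-unroomy vs ws (at us {h} {ts} _ singles) single lv l roomy =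
  1+n≰n (≤-trans (s≤s (≤-reflexive (solve (length us) (length ts))))
    (subst₂ (λ i j → 2 + i ≤ j) lss (cong₂ _+_ lus lws)
      (Room.between (roomy (us ∷ʳ h) (ts ++ vs) ws regroup (All.++⁺ singles single))
        (subst (1 ≤_) (sym lus) (s≤s z≤n)) (subst (1 ≤_) (sym lws) (s≤s z≤n)))))
  where
  regroup : (us ++ h ∷ ts) ++ vs ++ ws ≡ us ∷ʳ h ++ (ts ++ vs) ++ ws
  regroup = trans (++-assoc us (h ∷ ts) (vs ++ ws))
    (trans (cong (λ z → us ++ h ∷ z) (sym (++-assoc ts vs ws))) (sym (∷ʳ-++ us h ((ts ++ vs) ++ ws))))
  lus : length (us ∷ʳ h) ≡ suc (length us)
  lus = length-++-comm us [ h ]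
  lss : length (ts ++ vs) ≡ length ts + suc (length us)
  lss = trans (length-++ ts) (cong (length ts +_) lv)
  lws : length ws ≡ suc (length ts)
  lws = +-cancelˡ-≡ (suc (length us)) (length ws) (suc (length ts)) (begin
    suc (length us) + length ws         ≡⟨ cong (_+ length ws) lv ⟨
    length vs + length ws               ≡⟨ length-++ vs ⟨
    length (vs ++ ws)                   ≡⟨ l ⟩
    suc (length (us ++ h ∷ ts))         ≡⟨ cong suc (length-++ us) ⟩
    suc (length us) + suc (length ts)   ∎)
    where open ≡-Reasoning
  solve : ∀ u t → suc u + suc t ≡ suc (t + suc u)
  solve = solve-∀

-- Time bounds and the theorem.

scan-time : ∀ (us vs : List Group) {t} → length vs ≡ suc (length us) → t ≤ length us * 8 + 6 →
            5 + (length us * 11 + t) ≤ 19 * length (us ++ vs)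
scan-time us vs {t} lv t≤ = begin
  5 + (m * 11 + t)                         ≤⟨ +-monoʳ-≤ 5 (+-monoʳ-≤ (m * 11) t≤) ⟩
  -- Scan and search cost at most 11 and 8 steps per group of the first half; `19 * m + 8` is the
  -- slack left in 19 times `m + suc m`.
  5 + (m * 11 + (m * 8 + 6))               ≤⟨ m≤m+n (5 + (m * 11 + (m * 8 + 6))) (19 * m + 8) ⟩
  5 + (m * 11 + (m * 8 + 6)) + (19 * m + 8) ≡⟨ solve m ⟩
  19 * (m + suc m)                         ≡⟨ cong (λ l → 19 * (m + l)) lv ⟨
  19 * (m + length vs)                     ≡⟨ cong (19 *_) (length-++ us) ⟨
  19 * length (us ++ vs)                   ∎
  where
  open ≤-Reasoning
  m = length us
  solve : ∀ m → 5 + (m * 11 + (m * 8 + 6)) + (19 * m + 8) ≡ 19 * (m + suc m)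
  solve = solve-∀

-- The negative case refutes `Roomy`, which `solution-roomy` shows to be necessary for solvability.
decide : ∀ {gs} → WellFormed gs → Odd (length gs) →
  (Solvable (blocks gs) × decider on encode (reduce gs) Outputs (1 ∷ []) Within (19 * length gs))
  ⊎ (¬ Roomy gs × decider on encode (reduce gs) Outputs (0 ∷ []) Within (19 * length gs))
decide {gs} wf odd with halve gs odd
... | halves us vs lv =
  let pos , pos′ = All.++⁻ us (proj₂ wf)
      p , m , lb , sc , rest = scanHalf-correct {searchAndDecide} us vs pos lv
  in decide-rest lb sc (λ {T} {zs} → rest {T} {zs}) lv wf
       (search vs p pos′ (subst (p <_) (sym lv) (s≤s (lastBig-≤ lb))))
  where
  decide-rest : ∀ {us vs p m s} → LastBig us p → Scanned m (length us) p →
    (∀ {T zs} → decider ⊢ ⟨ 14 , m , tape vs , [] ⟩ ⇓≤[ T ] zs →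
      decider ⊢ s ⇓≤[ 5 + (length us * 11 + T) ] zs) →
    length vs ≡ suc (length us) → WellFormed (us ++ vs) → Search vs p →
    (Solvable (blocks (us ++ vs)) × decider ⊢ s ⇓≤[ 19 * length (us ++ vs) ] (1 ∷ []))
    ⊎ (¬ Roomy (us ++ vs) × decider ⊢ s ⇓≤[ 19 * length (us ++ vs) ] (0 ∷ []))
  decide-rest {us} {vs} lb sc rest lv wf (found ss g ws a single big) =
    inj₁ ((_ , found-solution ss g ws a lb refl lv big wf) ,
          within (scan-time us vs lv
            -- At most `p` candidates are rejected, and `p` is at most `length us`.
            (+-mono-≤ (*-mono-≤ (≤-trans (m≤m+n (length ss) a) (lastBig-≤ lb)) (n≤1+n 7)) (n≤1+n 5)))
            (rest (decider-found ss g ws single big sc)))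
  decide-rest {us} {vs} lb sc rest lv wf (missed ss ws single ls) =
    inj₂ (missed-unroomy ss ws lb single ls lv ,
          within (scan-time us vs lv (+-monoˡ-≤ 6 (*-mono-≤ (lastBig-≤ lb) (n≤1+n 7))))
            (rest (decider-missed ss ws single ls sc)))

solve : ∀ {gs} → WellFormed gs → Odd (length gs) → Roomy gs →
  ∃[ is ] (Solution (blocks gs) is × solver on encode (reduce gs) Outputs is Within (19 * length gs))
solve {gs} wf odd roomy with halve gs odd
... | halves us vs lv =
  let pos , pos′ = All.++⁻ us (proj₂ wf)
      p , m , lb , sc , rest = scanHalf-correct {searchAndSolve} us vs pos lv
  in solve-rest lb sc (λ {T} {zs} → rest {T} {zs}) lv wf roomy
       (search vs p pos′ (subst (p <_) (sym lv) (s≤s (lastBig-≤ lb))))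
  where
  solve-rest : ∀ {us vs p m s} → LastBig us p → Scanned m (length us) p →
    (∀ {T zs} → solver ⊢ ⟨ 14 , m , tape vs , [] ⟩ ⇓≤[ T ] zs →
      solver ⊢ s ⇓≤[ 5 + (length us * 11 + T) ] zs) →
    length vs ≡ suc (length us) → WellFormed (us ++ vs) → Roomy (us ++ vs) → Search vs p →
    ∃[ is ] (Solution (blocks (us ++ vs)) is × solver ⊢ s ⇓≤[ 19 * length (us ++ vs) ] is)
  solve-rest lb sc rest lv wf roomy (missed ss ws single ls) =
    contradiction roomy (missed-unroomy ss ws lb single ls lv)
  solve-rest {us} {vs} {m = m} lb sc rest lv wf roomy (found ss g ws a single big) =
    _ , found-solution ss g ws a lb refl lv big wf ,
    within (scan-time us vs lv time)
      (rest (solver-found ss g ws single big (subst (λ i → Scanned m i _) us≡ sc)))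
    where
    open ≤-Reasoning
    -- The median position is the number of shifting clicks plus the final median position.
    us≡ : length us ≡ length ss + length ws
    us≡ = suc-injective (trans (sym lv) (trans (length-++ ss) (+-suc (length ss) (length ws))))
    rearrange : ∀ s w → s * 8 + (4 + (w * 4 + 2)) + w * 4 ≡ (s + w) * 8 + 6
    rearrange = solve-∀
    time : length ss * 8 + (4 + (length ws * 4 + 2)) ≤ length us * 8 + 6
    time = begin
      length ss * 8 + (4 + (length ws * 4 + 2))                 ≤⟨ m≤m+n _ (length ws * 4) ⟩
      length ss * 8 + (4 + (length ws * 4 + 2)) + length ws * 4 ≡⟨ rearrange (length ss) (length ws) ⟩
      (length ss + length ws) * 8 + 6                           ≡⟨ cong (λ i → i * 8 + 6) us≡ ⟨
      length us * 8 + 6                                         ∎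

corollary11 : (∃[ P ] ∃[ c ] ∀ (n : ℕ) → Odd n → ∀ (w : Word) → length (groups w) ≡ n →
    (Solvable w × P on encode (reduce (groups w)) Outputs (1 ∷ []) Within (c * n))
    ⊎ (¬ Solvable w × P on encode (reduce (groups w)) Outputs (0 ∷ []) Within (c * n)))
    ×
    (∃[ P ] ∃[ c ] ∀ (n : ℕ) → Odd n → ∀ (w : Word) → length (groups w) ≡ n → Solvable w →
    ∃[ is ] (Solution w is × P on encode (reduce (groups w)) Outputs is Within (c * n)))
corollary11 = (decider , 19 , decides) , (solver , 19 , solves)
  where
  decides : ∀ n → Odd n → ∀ w → length (groups w) ≡ n →
    (Solvable w × decider on encode (reduce (groups w)) Outputs (1 ∷ []) Within (19 * n))
    ⊎ (¬ Solvable w × decider on encode (reduce (groups w)) Outputs (0 ∷ []) Within (19 * n))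
  decides _ odd w refl with decide (groups-wellFormed w) odd
  ... | inj₁ (solvable , run) = inj₁ (subst Solvable (blocks-groups w) solvable , run)
  ... | inj₂ (cramped , run)  = inj₂ ((λ (_ , sol) → cramped (solution-roomy sol)) , run)
  solves : ∀ n → Odd n → ∀ w → length (groups w) ≡ n → Solvable w →
    ∃[ is ] (Solution w is × solver on encode (reduce (groups w)) Outputs is Within (19 * n))
  solves _ odd w refl (_ , sol) =
    let is , sol′ , run = solve (groups-wellFormed w) odd (solution-roomy sol)
    in is , subst (λ v → Solution v is) (blocks-groups w) sol′ , run
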